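{- Let $\mathbb{V}$ be a vector space of dimension $n$ over a finite field $\mathbb{F}$ with $q$ elements, with basis $\{b_1,b_2,\ldots,b_n\}$, and let $\Gamma(\mathbb{V})$ be its non-zero component graph with respect to this basis. (a) If $q=2$ and $n\ge 3$, then $\lambda(\Gamma(\mathbb{V}))=n$. (b) If $q\ge 3$, then $\lambda(\Gamma(\mathbb{V}))=\sum_{i=1}^{n}\binom{n}{i}\left((q-1)^i-1\right)$.
   Context: Non-zero component graph: given a finite-dimensional vector space $\mathbb{V}$ over $\mathbb{F}$ with basis $\{b_1,\ldots,b_n\}$ ($n\ge 1$), $\Gamma(\mathbb{V})$ is the simple graph whose vertices are the non-zero vectors of $\mathbb{V}$; two distinct vertices are adjacent if and only if there is some $b_i$ that has non-zero coefficient in the unique linear combinations (with respect to the basis) of both. For a graph $\Gamma$ and a vertex $u$, $N(u)=\{v\in V(\Gamma): uv\in E(\Gamma)\}$ is the open neighborhood. A set $L_D\subseteq V(\Gamma)$ is a locating-dominating set for $\Gamma$ if for every two distinct vertices $u,v\in V(\Gamma)\setminus L_D$ we have $\emptyset\ne N(u)\cap L_D\ne N(v)\cap L_D\ne\emptyset$ (i.e. both intersections are non-empty and they are different from each other). The location-domination number $\lambda(\Gamma)$ is the minimum cardinality of a locating-dominating set of $\Gamma$. -}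

module Defs where

open import Algebra.Apartness.Bundles using (HeytingField; HeytingCommutativeRing)
open import Algebra.Bundles using (CommutativeRing)
open import Algebra.Module.Bundles using (Module)
import Algebra.Properties.AbelianGroup as AbelianGroupProperties
import Algebra.Properties.CommutativeMonoid.Sum as CommutativeMonoidSum
open import Data.Fin.Base using (Fin; toℕ)
open import Data.Nat.Base using (ℕ; suc; _≤_)
open import Data.Nat.Properties using (+-0-commutativeMonoid)
open import Data.Product.Base using (Σ; Σ-syntax; ∃-syntax; _×_; _,_; proj₁; proj₂)
open import Data.Vec.Functional using (Vector)
open import Function.Base using (_∘_)
open import Function.Bundles using (Inverse)
open import Level using (Level; _⊔_) renaming (suc to lsuc)
open import Relation.Binary.Bundles using (Setoid)
open import Relation.Binary.Core using (Rel)
open import Relation.Binary.Definitions using (Symmetric; Irreflexive; _Respects_; _Respects₂_)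
import Relation.Binary.Construct.On as On
import Relation.Binary.PropositionalEquality.Properties as ≡
import Relation.Binary.Reasoning.Setoid as SetoidReasoning
open import Relation.Nullary.Negation using (¬_)
open import Relation.Unary using (Pred; _∈_; _∉_; _∩_; _≐_; Satisfiable)

private
  variable
    a ℓ v e c ℓ₁ ℓ₂ m ℓm : Level

infix 4 _HasCardinality_

_HasCardinality_ : Setoid a ℓ → ℕ → Set (a ⊔ ℓ)
S HasCardinality k = Inverse S (≡.setoid (Fin k))

∑₁ : ℕ → (ℕ → ℕ) → ℕ
∑₁ n f = ∑[ i < n ] f (suc (toℕ i))   -- f 1 + f 2 + ⋯ + f n
  where open CommutativeMonoidSum +-0-commutativeMonoid

record SimpleGraph (v ℓ e : Level) : Set (lsuc (v ⊔ ℓ ⊔ e)) where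
  infix 4 _~_
  field
    vertices : Setoid v ℓ

  open Setoid vertices public using (_≈_; _≉_) renaming (Carrier to Vertex)

  field
    _~_      : Rel Vertex e
    ~-resp-≈ : _~_ Respects₂ _≈_
    ~-sym    : Symmetric _~_
    ~-irrefl : Irreflexive _≈_ _~_

  N : Vertex → Pred Vertex e
  N u = u ~_

module _ (Γ : SimpleGraph v ℓ e) where
  open SimpleGraph Γ

  -- Sets of vertices are predicates valued in Set ℓ.  This loses no generality
  -- for sets with a cardinality: a set enumerated by f : Fin k → Vertex is
  -- equivalent to λ w → ∃[ i ] f i ≈ w, which lives at level ℓ.
  record VertexSet : Set (v ⊔ lsuc ℓ) where
    field
      member : Pred Vertex ℓ
      resp   : member Respects _≈_

    elements : Setoid (v ⊔ ℓ) ℓ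
    elements = On.setoid {B = Σ Vertex member} vertices proj₁

  open VertexSet

  IsLocatingDominating : VertexSet → Set (v ⊔ ℓ ⊔ e)
  IsLocatingDominating L = ∀ u w → u ∉ member L → w ∉ member L → u ≉ w →
    Satisfiable (N u ∩ member L) ×
    ¬ (N u ∩ member L ≐ N w ∩ member L) ×
    Satisfiable (N w ∩ member L)

  IsLocationDominationNumber : ℕ → Set (v ⊔ lsuc ℓ ⊔ e)
  IsLocationDominationNumber k =
    (Σ[ L ∈ VertexSet ] IsLocatingDominating L × elements L HasCardinality k) ×
    (∀ L l → IsLocatingDominating L → elements L HasCardinality l → k ≤ l)

-- A finite Heyting field has decidable equality, so _≉_ coincides there with
-- the apartness _#_ and every x ≉ 0# is invertible; below "non-zero" is _≉_.
fieldRing : HeytingField c ℓ₁ ℓ₂ → CommutativeRing c ℓ₁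
fieldRing F = HeytingCommutativeRing.commutativeRing (HeytingField.heytingCommutativeRing F)

VectorSpace : HeytingField c ℓ₁ ℓ₂ → (m ℓm : Level) → Set (c ⊔ ℓ₁ ⊔ lsuc (m ⊔ ℓm))
VectorSpace F m ℓm = Module (fieldRing F) m ℓm

module _ (F : HeytingField c ℓ₁ ℓ₂) (V : VectorSpace F m ℓm) where
  open CommutativeRing (fieldRing F)
  open Module V
  private
    module ∑ᴹ = CommutativeMonoidSum +ᴹ-commutativeMonoid

  linearCombination : ∀ {n} → Vector Carrier n → Vector Carrierᴹ n → Carrierᴹ
  linearCombination {n} x b = ∑[ i < n ] (x i *ₗ b i)
    where open ∑ᴹ

  record IsBasis {n} (b : Vector Carrierᴹ n) : Set (c ⊔ ℓ₁ ⊔ m ⊔ ℓm) where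
    field
      linearlyIndependent : ∀ x → linearCombination x b ≈ᴹ 0ᴹ → ∀ i → x i ≈ 0#
      spanning            : ∀ u → ∃[ x ] u ≈ᴹ linearCombination x b

    coefficient : Carrierᴹ → Vector Carrier n
    coefficient u = proj₁ (spanning u)

    coefficients-unique : ∀ x y → linearCombination x b ≈ᴹ linearCombination y b →
                          ∀ i → x i ≈ y i
    coefficients-unique x y x≈y i = x∙y⁻¹≈ε⇒x≈y _ _ (linearlyIndependent (λ j → x j - y j) diff≈0 i)
      where
      open SetoidReasoning ≈ᴹ-setoid
      open AbelianGroupProperties +-abelianGroup using (x∙y⁻¹≈ε⇒x≈y)
      -y : Vector Carrier n
      -y j = - y j
      lc : Vector Carrier n → Carrierᴹ
      lc z = linearCombination z b
      split : ∀ z w → lc (λ j → z j + w j) ≈ᴹ lc z +ᴹ lc w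
      split z w = begin
        lc (λ j → z j + w j)                       ≈⟨ ∑ᴹ.sum-cong-≋ (λ j → *ₗ-distribʳ (b j) (z j) (w j)) ⟩
        ∑ᴹ.sum (λ j → z j *ₗ b j +ᴹ w j *ₗ b j)    ≈⟨ ∑ᴹ.∑-distrib-+ (λ j → z j *ₗ b j) (λ j → w j *ₗ b j) ⟩
        lc z +ᴹ lc w                               ∎
      diff≈0 : lc (λ j → x j - y j) ≈ᴹ 0ᴹ
      diff≈0 = begin
        lc (λ j → x j - y j)   ≈⟨ split x -y ⟩
        lc x +ᴹ lc -y          ≈⟨ +ᴹ-congʳ x≈y ⟩
        lc y +ᴹ lc -y          ≈⟨ split y -y ⟨
        lc (λ j → y j - y j)   ≈⟨ ∑ᴹ.sum-cong-≋ (λ j → ≈ᴹ-trans (*ₗ-congʳ (-‿inverseʳ (y j))) (*ₗ-zeroˡ (b j))) ⟩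
        ∑ᴹ.sum {n} (λ _ → 0ᴹ)  ≈⟨ ∑ᴹ.sum-replicate-zero n ⟩
        0ᴹ                     ∎

    coefficient-cong : ∀ {u w} → u ≈ᴹ w → ∀ i → coefficient u i ≈ coefficient w i
    coefficient-cong {u} {w} u≈w = coefficients-unique (coefficient u) (coefficient w)
      (≈ᴹ-trans (≈ᴹ-sym (proj₂ (spanning u))) (≈ᴹ-trans u≈w (proj₂ (spanning w))))

  nonZeroVectors : Setoid (m ⊔ ℓm) ℓm
  nonZeroVectors = On.setoid {B = Σ[ u ∈ Carrierᴹ ] u ≉ᴹ 0ᴹ} ≈ᴹ-setoid proj₁

  nonZeroComponentGraph : ∀ {n} {b : Vector Carrierᴹ n} → IsBasis b →
                          SimpleGraph (m ⊔ ℓm) ℓm (ℓ₁ ⊔ ℓm)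
  nonZeroComponentGraph B = record
    { vertices = nonZeroVectors
    ; _~_      = λ (u , _) (w , _) →
                   u ≉ᴹ w × ∃[ i ] coefficient u i ≉ 0# × coefficient w i ≉ 0#
    ; ~-resp-≈ =
        (λ p≈q (u≉p , i , ui , pi) →
          (λ u≈q → u≉p (≈ᴹ-trans u≈q (≈ᴹ-sym p≈q))) ,
          i , ui , pi ∘ trans (coefficient-cong p≈q i)) ,
        (λ p≈q (p≉u , i , pi , ui) →
          (λ q≈u → p≉u (≈ᴹ-trans p≈q q≈u)) ,
          i , pi ∘ trans (coefficient-cong p≈q i) , ui)
    ; ~-sym    = λ (u≉w , i , ui , wi) → u≉w ∘ ≈ᴹ-sym , i , wi , ui
    ; ~-irrefl = λ u≈w (u≉w , _) → u≉w u≈w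
    }
    where open IsBasis B

{-# OPTIONS --safe #-}
-- Vectors with the same support are twins, so a locating-dominating set misses
-- at most one vector of each of the 2ⁿ − 1 non-empty supports.  Conversely, a
-- set L that contains t·bᵢ for a fixed t ≠ 0 and all i, and outside of which
-- all coefficients are 0 or 1, is locating-dominating: t·bᵢ detects whether i
-- lies in the support, and outside L the support determines the vector.  For
-- q ≥ 3 take t ≠ 1 and L the vectors with a coefficient other than 0 and 1;
-- for q = 2 take t = 1 and L = {b₁, …, bₙ}.  For q = 2 the lower bound is that
-- vectors outside L have distinct traces on L, so 2ⁿ ≤ 1 + |L| + 2^|L|.
module Submission where

open import Defs
open import Algebra.Apartness.Bundles using (HeytingField)
open import Algebra.Module.Bundles using (Module)
open import Data.Nat.Base using (ℕ; _*_; _∸_; _^_; _≤_)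
open import Data.Nat.Combinatorics using (_C_)
open import Data.Product.Base using (_×_)
open import Data.Vec.Functional using (Vector)
open import Level using (Level)
open import Algebra.Bundles using (CommutativeRing)
open import Relation.Binary.PropositionalEquality.Core using (_≡_)

import Algebra.Properties.CommutativeMonoid.Sum as CommutativeMonoidSum
import Algebra.Properties.CommutativeSemiring.Binomial as CommutativeSemiringBinomial
import Algebra.Properties.Ring as RingProperties
import Algebra.Properties.Semiring.Exp as SemiringExp
import Algebra.Properties.Semiring.Mult as SemiringMult
open import Data.Bool.Base using (if_then_else_)
open import Data.Empty using (⊥)
open import Data.Fin.Base using (Fin; zero; suc; toℕ; splitAt; join; combine; funToFin; finToFun; punchIn; punchOut)
open import Data.Fin.Patterns using (0F; 1F)
import Data.Fin.Properties as Fin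
open import Data.Nat.Base using (zero; suc; _+_; s≤s; z≤n)
open import Data.Nat.Properties hiding (_≟_)
open import Data.Product.Base using (Σ; Σ-syntax; ∃-syntax; _,_; proj₁; proj₂; map₂)
open import Data.Sum.Base as Sum using (_⊎_; inj₁; inj₂; [_,_]′)
open import Data.Sum.Properties using (inj₁-injective; inj₂-injective)
open import Data.Vec.Functional using (replicate; updateAt)
open import Data.Vec.Functional.Properties using (updateAt-updates; updateAt-minimal)
open import Function.Base using (_∘_; const)
open import Function.Bundles using (Inverse)
open import Function.Definitions using (Injective)
open import Relation.Binary.Bundles using (Setoid)
open import Relation.Binary.Definitions using () renaming (Decidable to Decidable₂)
open import Relation.Binary.PropositionalEquality.Core using (_≢_; refl; cong; cong₂; sym; trans; subst)
open import Relation.Binary.PropositionalEquality.Properties using (module ≡-Reasoning)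
open import Relation.Nullary.Decidable using (Dec; yes; no; does; map′; ¬?; _×-dec_; decidable-stable)
open import Relation.Nullary.Negation using (¬_; contradiction)
open import Relation.Unary using (Pred; Decidable; _∈_; _∉_; _∩_; _≐_)

private
  variable
    p v ℓ e : Level
    k m n : ℕ

-- Counting by injections, and codes for finite functions and subsets.

⊎-injective⇒≤ : {f : Fin m → Fin k} {g : Fin n → Fin k} → Injective _≡_ _≡_ f → Injective _≡_ _≡_ g →
                (∀ i j → f i ≢ g j) → m + n ≤ k
⊎-injective⇒≤ {m} {k} {n} {f} {g} f-inj g-inj disjoint =
  Fin.injective⇒≤ {f = h ∘ splitAt m} λ {i} {j} eq →
    trans (sym (Fin.join-splitAt m n i)) (trans (cong (join m n) (h-injective {splitAt m i} {splitAt m j} eq)) (Fin.join-splitAt m n j))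
  where
  h : Fin m ⊎ Fin n → Fin k
  h = [ f , g ]′
  h-injective : Injective _≡_ _≡_ h
  h-injective {inj₁ _} {inj₁ _} eq = cong inj₁ (f-inj eq)
  h-injective {inj₁ _} {inj₂ _} eq = contradiction eq (disjoint _ _)
  h-injective {inj₂ _} {inj₁ _} eq = contradiction (sym eq) (disjoint _ _)
  h-injective {inj₂ _} {inj₂ _} eq = cong inj₂ (g-inj eq)

injective-⊎⇒≤ : {f : Fin k → Fin m ⊎ Fin n} → Injective _≡_ _≡_ f → k ≤ m + n
injective-⊎⇒≤ {m = m} {n} {f} f-inj = Fin.injective⇒≤ {f = join m n ∘ f} λ {i} {j} eq →
  f-inj (trans (sym (Fin.splitAt-join m n (f i))) (trans (cong (splitAt m) eq) (Fin.splitAt-join m n (f j))))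

-- The number `k` of solutions is left existential. For `q ≥ 3` it becomes the size of the optimal
-- set, and its value is found afterwards from two inequalities.
enumerate : {P : Pred (Fin n) p} → Decidable P →
            ∃[ k ] Σ[ f ∈ (Fin k → Fin n) ]
              Injective _≡_ _≡_ f × (∀ j → P (f j)) × (∀ i → P i → ∃[ j ] f j ≡ i)
enumerate {n = zero} P? = 0 , (λ ()) , (λ { {()} }) , (λ ()) , λ ()
enumerate {n = suc n} {P = P} P? with P? zero | enumerate (P? ∘ suc)
... | no ¬P₀ | k , f , f-inj , sound , complete = k , suc ∘ f , f-inj ∘ Fin.suc-injective , sound , complete′
  where
  complete′ : ∀ i → P i → ∃[ j ] suc (f j) ≡ i
  complete′ zero    P₀ = contradiction P₀ ¬P₀
  complete′ (suc i) Pᵢ = map₂ (cong suc) (complete i Pᵢ)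
... | yes P₀ | k , f , f-inj , sound , complete = suc k , f′ , f′-inj , sound′ , complete′
  where
  f′ : Fin (suc k) → Fin (suc n)
  f′ zero    = zero
  f′ (suc j) = suc (f j)
  f′-inj : Injective _≡_ _≡_ f′
  f′-inj {zero}  {zero}  _  = refl
  f′-inj {suc _} {suc _} eq = cong suc (f-inj (Fin.suc-injective eq))
  sound′ : ∀ j → P (f′ j)
  sound′ zero    = P₀
  sound′ (suc j) = sound j
  complete′ : ∀ i → P i → ∃[ j ] f′ j ≡ i
  complete′ zero    _  = zero , refl
  complete′ (suc i) Pᵢ with j , eq ← complete i Pᵢ = suc j , cong suc eq

funToFin-cong : {f g : Fin m → Fin n} → (∀ i → f i ≡ g i) → funToFin f ≡ funToFin g
funToFin-cong {zero}  _   = refl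
funToFin-cong {suc m} f≗g = cong₂ combine (f≗g zero) (funToFin-cong (f≗g ∘ suc))

funToFin-injective : {f g : Fin m → Fin n} → funToFin f ≡ funToFin g → ∀ i → f i ≡ g i
funToFin-injective {f = f} {g} eq i =
  trans (sym (Fin.finToFun-funToFin f i)) (trans (cong (λ c → finToFun c i) eq) (Fin.finToFun-funToFin g i))

finToFun-injective : {c d : Fin (m ^ n)} → (∀ i → finToFun {m} {n} c i ≡ finToFun d i) → c ≡ d
finToFun-injective {m} {n} {c} {d} eq =
  trans (sym (Fin.funToFin-finToFin {n} {m} c)) (trans (funToFin-cong eq) (Fin.funToFin-finToFin {n} {m} d))

-- A decidable subset coded as a number, so that comparing subsets becomes equality in a type with
-- `2 ^ n` elements.
indicator : {P : Pred (Fin n) p} → Decidable P → Fin (2 ^ n)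
indicator P? = funToFin λ i → if does (P? i) then 1F else 0F

indicator-⊆ : ∀ {q} {P : Pred (Fin n) p} {Q : Pred (Fin n) q} (P? : Decidable P) (Q? : Decidable Q) →
              indicator P? ≡ indicator Q? → ∀ i → P i → Q i
indicator-⊆ P? Q? eq i Pᵢ with P? i | Q? i | funToFin-injective eq i
... | _      | yes Qᵢ | _  = Qᵢ
... | yes _  | no _   | ()
... | no ¬Pᵢ | no _   | _  = contradiction Pᵢ ¬Pᵢ

Fin2-dichotomy : {i j : Fin 2} → i ≢ j → ∀ k → k ≡ i ⊎ k ≡ j
Fin2-dichotomy {0F} {0F} i≢j _  = contradiction refl i≢j
Fin2-dichotomy {0F} {1F} _   0F = inj₁ refl
Fin2-dichotomy {0F} {1F} _   1F = inj₂ refl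
Fin2-dichotomy {1F} {0F} _   0F = inj₂ refl
Fin2-dichotomy {1F} {0F} _   1F = inj₁ refl
Fin2-dichotomy {1F} {1F} i≢j _  = contradiction refl i≢j

avoid-two : 3 ≤ n → ∀ (i j : Fin n) → ∃[ k ] k ≢ i × k ≢ j
avoid-two (s≤s (s≤s (s≤s _))) i j with i Fin.≟ j
... | yes refl = punchIn i zero , Fin.punchInᵢ≢i i zero , Fin.punchInᵢ≢i i zero
-- In the complement of `i`, the element `j` sits at position `punchOut i≢j`, so it suffices to
-- avoid that position there.
... | no i≢j   = punchIn i (punchIn (punchOut i≢j) zero) , Fin.punchInᵢ≢i i _ , λ eq →
  Fin.punchInᵢ≢i (punchOut i≢j) zero
    (Fin.punchIn-injective i _ _ (trans eq (sym (Fin.punchIn-punchOut i≢j))))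

-- Powers of two against linear terms.

2+n≤2^n : 2 ≤ n → 2 + n ≤ 2 ^ n
2+n≤2^n {1}               (s≤s ())
2+n≤2^n {2}               _ = ≤-refl
2+n≤2^n {suc n@(suc (suc _))} _ =
  +-mono-≤ (m^n>0 2 n) (≤-trans (2+n≤2^n {n} (s≤s (s≤s z≤n))) (m≤m+n _ 0))

-- If `l ≤ r = n - 1`, the hypothesis gives `2 ^ r + 2 ^ r ≤ suc r + 2 ^ r`, hence `2 ^ r ≤ suc r`.
-- This contradicts `2+n≤2^n` at `r`, which applies because `3 ≤ n` means `2 ≤ r`.
2^n≤l+1+2^l⇒n≤l : ∀ {l} → 3 ≤ n → 2 ^ n ≤ l + suc (2 ^ l) → n ≤ l
2^n≤l+1+2^l⇒n≤l {n = n@(suc r)} {l} (s≤s 2≤r) 2^n≤ = ≮⇒≥ λ { (s≤s l≤r) →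
  1+n≰n (≤-trans (2+n≤2^n 2≤r) (+-cancelʳ-≤ (2 ^ r) _ _ (begin
    2 ^ r + 2 ^ r      ≡⟨ cong (2 ^ r +_) (+-identityʳ (2 ^ r)) ⟨
    2 ^ n              ≤⟨ 2^n≤ ⟩
    l + suc (2 ^ l)    ≤⟨ +-mono-≤ l≤r (s≤s (^-monoʳ-≤ 2 l≤r)) ⟩
    r + suc (2 ^ r)    ≡⟨ +-suc r (2 ^ r) ⟩
    suc r + 2 ^ r      ∎))) }
  where open ≤-Reasoning

-- The binomial identity behind the closed formula.

module _ (x : ℕ) where
  open CommutativeMonoidSum +-0-commutativeMonoid using (sum; sum-cong-≗)
  open SemiringExp +-*-semiring using () renaming (_^_ to _^ˢ_)
  open SemiringMult +-*-semiring using () renaming (_×_ to _×ˢ_)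
  open CommutativeSemiringBinomial +-*-commutativeSemiring using (binomialTerm; theorem)
  open ≡-Reasoning

  private
    ×ˢ≡* : ∀ m y → m ×ˢ y ≡ m * y
    ×ˢ≡* zero    y = refl
    ×ˢ≡* (suc m) y = cong (y +_) (×ˢ≡* m y)

    ^ˢ≡^ : ∀ y m → y ^ˢ m ≡ y ^ m
    ^ˢ≡^ y zero    = refl
    ^ˢ≡^ y (suc m) = cong (y *_) (^ˢ≡^ y m)

  [x+1]^n : ∀ n → (x + 1) ^ n ≡ 1 + ∑₁ n (λ i → (n C i) * x ^ i)
  [x+1]^n n = begin
    (x + 1) ^ n                                        ≡⟨ ^ˢ≡^ (x + 1) n ⟨
    (x + 1) ^ˢ n                                       ≡⟨ theorem n x 1 ⟩
    sum (binomialTerm x 1 n)                           ≡⟨ sum-cong-≗ term ⟩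
    -- The term at `i = 0` computes to 1, and what remains is a sum from 1 to `n`.
    1 + ∑₁ n (λ i → (n C i) * x ^ i)                   ∎
    where
    term : ∀ (i : Fin (suc n)) → binomialTerm x 1 n i ≡ (n C toℕ i) * x ^ toℕ i
    term i = begin
      (n C toℕ i) ×ˢ (x ^ˢ toℕ i * 1 ^ˢ (n ∸ toℕ i))  ≡⟨ ×ˢ≡* (n C toℕ i) _ ⟩
      (n C toℕ i) * (x ^ˢ toℕ i * 1 ^ˢ (n ∸ toℕ i))   ≡⟨ cong ((n C toℕ i) *_) (cong₂ _*_ (^ˢ≡^ x (toℕ i))
                                                           (trans (^ˢ≡^ 1 (n ∸ toℕ i)) (^-zeroˡ (n ∸ toℕ i)))) ⟩
      (n C toℕ i) * (x ^ toℕ i * 1)                    ≡⟨ cong ((n C toℕ i) *_) (*-identityʳ _) ⟩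
      (n C toℕ i) * x ^ toℕ i                          ∎

-- With `r = q - 1`, this is the expansion of `(r + 1) ^ n` minus that of `(1 + 1) ^ n`, term by
-- term. The terms at 0 cancel, and the truncated subtraction is exact because `r ^ i ≥ 1`.
Σ-binomial : ∀ q n → 2 ≤ q → ∑₁ n (λ i → (n C i) * ((q ∸ 1) ^ i ∸ 1)) + 2 ^ n ≡ q ^ n
Σ-binomial (suc r@(suc _)) n (s≤s _) = begin
  ∑₁ n (λ i → (n C i) * (r ^ i ∸ 1)) + 2 ^ n
    ≡⟨ cong (∑₁ n (λ i → (n C i) * (r ^ i ∸ 1)) +_) ([x+1]^n 1 n) ⟩
  ∑₁ n (λ i → (n C i) * (r ^ i ∸ 1)) + (1 + ∑₁ n (λ i → (n C i) * 1 ^ i))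
    ≡⟨ +-suc _ _ ⟩
  1 + (∑₁ n (λ i → (n C i) * (r ^ i ∸ 1)) + ∑₁ n (λ i → (n C i) * 1 ^ i))
    ≡⟨ cong suc (∑-distrib-+ {n} _ _) ⟨
  1 + ∑₁ n (λ i → (n C i) * (r ^ i ∸ 1) + (n C i) * 1 ^ i)
    ≡⟨ cong suc (sum-cong-≗ {n} (λ i → term (suc (toℕ i)))) ⟩
  1 + ∑₁ n (λ i → (n C i) * r ^ i)
    ≡⟨ [x+1]^n r n ⟨
  (r + 1) ^ n
    ≡⟨ cong (_^ n) (+-comm r 1) ⟩
  suc r ^ n ∎
  where
  open CommutativeMonoidSum +-0-commutativeMonoid using (sum-cong-≗; ∑-distrib-+)
  open ≡-Reasoning
  term : ∀ i → (n C i) * (r ^ i ∸ 1) + (n C i) * 1 ^ i ≡ (n C i) * r ^ i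
  term i = begin
    (n C i) * (r ^ i ∸ 1) + (n C i) * 1 ^ i  ≡⟨ *-distribˡ-+ (n C i) _ _ ⟨
    (n C i) * (r ^ i ∸ 1 + 1 ^ i)            ≡⟨ cong (λ z → (n C i) * (r ^ i ∸ 1 + z)) (^-zeroˡ i) ⟩
    (n C i) * (r ^ i ∸ 1 + 1)                ≡⟨ cong ((n C i) *_) (m∸n+n≡m (m^n>0 r i)) ⟩
    (n C i) * r ^ i                          ∎

-- Vertex sets given by an enumeration.

module _ (Γ : SimpleGraph v ℓ e) where
  open SimpleGraph Γ
  private module Γ = Setoid vertices

  image : (Fin k → Vertex) → VertexSet Γ
  image f = record
    { member = λ u → ∃[ j ] f j ≈ u
    ; resp   = λ u≈w (j , fⱼ≈u) → j , Γ.trans fⱼ≈u u≈w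
    }

  -- The index of an element is read off its membership proof. Injectivity of `f` makes that index
  -- independent of the proof chosen.
  image-hasCardinality : {f : Fin k → Vertex} → Injective _≡_ _≈_ f →
                         VertexSet.elements (image f) HasCardinality k
  image-hasCardinality {f = f} f-inj = record
    { to        = λ (_ , j , _) → j
    ; from      = λ j → f j , j , Γ.refl
    ; to-cong   = λ {x} {y} → to-cong {x} {y}
    ; from-cong = λ { refl → Γ.refl }
    ; inverse   = (λ {j} {x} → to-cong {x} {f j , j , Γ.refl}) , λ { {u , j , fⱼ≈u} refl → fⱼ≈u }
    }
    where
    to-cong : ∀ {x y : Σ Vertex (VertexSet.member (image f))} → proj₁ x ≈ proj₁ y →
              proj₁ (proj₂ x) ≡ proj₁ (proj₂ y)
    to-cong {_ , _ , fᵢ≈u} {_ , _ , fⱼ≈w} u≈w = f-inj (Γ.trans fᵢ≈u (Γ.trans u≈w (Γ.sym fⱼ≈w)))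

-- The difference `1# - 0#` is invertible, with inverse `1#`, so `1#` is apart from `0#`, and
-- apartness is irreflexive.
0≉1 : ∀ {c ℓ₁ ℓ₂} (F : HeytingField c ℓ₁ ℓ₂) → let open CommutativeRing (fieldRing F) in 0# ≉ 1#
0≉1 F 0≈1 = #-irrefl (K.sym 0≈1) (invertible⇒# (1# , 1·[1-0]≈1 , K.trans (K.*-comm _ _) 1·[1-0]≈1))
  where
  open HeytingField F using (#-irrefl; invertible⇒#)
  module K = CommutativeRing (fieldRing F)
  open K using (_≈_; 0#; 1#; _-_) renaming (_*_ to _·_)
  open RingProperties K.ring using (-0#≈0#)
  1·[1-0]≈1 : 1# · (1# - 0#) ≈ 1#
  1·[1-0]≈1 = K.trans (K.*-identityˡ _) (K.trans (K.+-congˡ -0#≈0#) (K.+-identityʳ 1#))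

-- Coordinates over a finite field.

module _ {c ℓ₁ ℓ₂ m ℓm : Level} (F : HeytingField c ℓ₁ ℓ₂) {q : ℕ}
         (card : CommutativeRing.setoid (fieldRing F) HasCardinality q)
         (V : VectorSpace F m ℓm) {n : ℕ} {b : Vector (Module.Carrierᴹ V) n} (B : IsBasis F V b) where
  private
    module K = CommutativeRing (fieldRing F)
    module ι = Inverse card
  open K using (Carrier; 0#; 1#; _≈_; _≉_)
  open Module V using (Carrierᴹ; _≈ᴹ_; _≉ᴹ_; 0ᴹ; ≈ᴹ-refl; ≈ᴹ-sym; ≈ᴹ-trans; *ₗ-congʳ; +ᴹ-commutativeMonoid)
  open IsBasis B
  open CommutativeMonoidSum +ᴹ-commutativeMonoid using (sum-cong-≋)

  private
    Γ : SimpleGraph _ _ _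
    Γ = nonZeroComponentGraph F V B
    lc : Vector Carrier n → Carrierᴹ
    lc x = linearCombination F V x b
  open SimpleGraph Γ using (Vertex; _~_; N)
  open VertexSet using (member; resp; elements)

  infix 4 _≟_ _≟ᴹ_ _~?_

  to-injective : Injective _≈_ _≡_ ι.to
  to-injective {x} eq = K.trans (K.sym (ι.strictlyInverseʳ x)) (ι.inverseʳ eq)

  _≟_ : Decidable₂ _≈_
  x ≟ y = map′ to-injective ι.to-cong (ι.to x Fin.≟ ι.to y)

  lc-cong : ∀ {x y} → (∀ i → x i ≈ y i) → lc x ≈ᴹ lc y
  lc-cong x≈y = sum-cong-≋ λ i → *ₗ-congʳ (x≈y i)

  lc-coefficient : ∀ u → lc (coefficient u) ≈ᴹ u
  lc-coefficient u = ≈ᴹ-sym (proj₂ (spanning u))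

  coefficient-lc : ∀ x i → coefficient (lc x) i ≈ x i
  coefficient-lc x = coefficients-unique _ _ (lc-coefficient (lc x))

  coefficient-injective : ∀ {u w} → (∀ i → coefficient u i ≈ coefficient w i) → u ≈ᴹ w
  coefficient-injective {u} {w} eq =
    ≈ᴹ-trans (≈ᴹ-sym (lc-coefficient u)) (≈ᴹ-trans (lc-cong eq) (lc-coefficient w))

  _≟ᴹ_ : Decidable₂ _≈ᴹ_
  u ≟ᴹ w = map′ coefficient-injective coefficient-cong
    (Fin.all? λ i → coefficient u i ≟ coefficient w i)

  -- Finitely many indices and decidable equality of scalars turn the failure of a universal
  -- statement into a witness.
  ≉ᴹ⇒coefficient≉ : ∀ {u w} → u ≉ᴹ w → ∃[ i ] coefficient u i ≉ coefficient w i
  ≉ᴹ⇒coefficient≉ {u} {w} u≉w =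
    Fin.¬∀⟶∃¬ n _ (λ i → coefficient u i ≟ coefficient w i) (u≉w ∘ coefficient-injective)

  coefficient-0ᴹ : ∀ i → coefficient 0ᴹ i ≈ 0#
  coefficient-0ᴹ = linearlyIndependent (coefficient 0ᴹ) (lc-coefficient 0ᴹ)

  coefficient≉0⇒≉0ᴹ : ∀ {u i} → coefficient u i ≉ 0# → u ≉ᴹ 0ᴹ
  coefficient≉0⇒≉0ᴹ {i = i} uᵢ≉0 u≈0 = uᵢ≉0 (K.trans (coefficient-cong u≈0 i) (coefficient-0ᴹ i))

  ≉0ᴹ⇒coefficient≉0 : ∀ {u} → u ≉ᴹ 0ᴹ → ∃[ i ] coefficient u i ≉ 0#
  ≉0ᴹ⇒coefficient≉0 u≉0 with i , uᵢ≉0ᵢ ← ≉ᴹ⇒coefficient≉ u≉0 =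
    i , λ uᵢ≈0 → uᵢ≉0ᵢ (K.trans uᵢ≈0 (K.sym (coefficient-0ᴹ i)))

  decode : Fin (q ^ n) → Carrierᴹ
  decode d = lc (ι.from ∘ finToFun {q} {n} d)

  encode : Carrierᴹ → Fin (q ^ n)
  encode u = funToFin (ι.to ∘ coefficient u)

  decode-encode : ∀ u → decode (encode u) ≈ᴹ u
  decode-encode u = ≈ᴹ-trans
    (lc-cong λ i → ι.inverseʳ (Fin.finToFun-funToFin (ι.to ∘ coefficient u) i)) (lc-coefficient u)

  decode-injective : Injective _≡_ _≈ᴹ_ decode
  decode-injective {d} {d′} eq = finToFun-injective {q} {n} λ i →
    trans (sym (ι.strictlyInverseˡ _)) (trans (ι.to-cong (from≈ i)) (ι.strictlyInverseˡ _))
    where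
    from≈ : ∀ i → ι.from (finToFun {q} {n} d i) ≈ ι.from (finToFun d′ i)
    from≈ = coefficients-unique _ _ eq

  encode-lc-injective : ∀ {x y} → encode (lc x) ≡ encode (lc y) → ∀ i → x i ≈ y i
  encode-lc-injective {x} {y} eq = coefficients-unique x y
    (≈ᴹ-trans (≈ᴹ-sym (decode-encode (lc x)))
      (subst (λ d → decode d ≈ᴹ lc y) (sym eq) (decode-encode (lc y))))

  _~?_ : Decidable₂ _~_
  (u , _) ~? (w , _) = ¬? (u ≟ᴹ w) ×-dec
    Fin.any? (λ i → ¬? (coefficient u i ≟ 0#) ×-dec ¬? (coefficient w i ≟ 0#))

  -- Membership extended to all vectors, with `0ᴹ` outside every set, so that all `q ^ n` vectors
  -- can be counted together.
  Member : VertexSet Γ → Pred Carrierᴹ _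
  Member L u = Σ[ u≉0 ∈ u ≉ᴹ 0ᴹ ] member L (u , u≉0)

  -- Lower bounds on the size of a locating-dominating set.

  module Enumerated (L : VertexSet Γ) {l : ℕ} (card-L : elements L HasCardinality l) where
    private module η = Inverse card-L

    element : Fin l → Vertex
    element = proj₁ ∘ η.from

    ∈⇒element : ∀ {u} → u ∈ member L → ∃[ j ] proj₁ (element j) ≈ᴹ proj₁ u
    ∈⇒element {u} u∈L = η.to (u , u∈L) , η.strictlyInverseʳ (u , u∈L)

    -- The enumeration makes membership decidable: search the finite list of elements for a vector
    -- equal to `u`.
    Member? : Decidable (Member L)
    Member? u = map′
      (λ (j , eq) → let ((w , w≉0) , w∈L) = η.from j
                        u≉0 = λ u≈0 → w≉0 (≈ᴹ-trans eq u≈0)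
                    in u≉0 , resp L eq w∈L)
      (λ (_ , u∈L) → ∈⇒element u∈L)
      (Fin.any? λ j → proj₁ (element j) ≟ᴹ u)

    -- Send a vector in `L` to its index and any other vector to its label under `g`. The result is
    -- an injection into `Fin l ⊎ Fin M`. Both lower bounds come from a choice of `g`.
    q^n≤l+ : ∀ {M} (g : Carrierᴹ → Fin M) →
             (∀ {u w} → u ∉ Member L → w ∉ Member L → g u ≡ g w → u ≈ᴹ w) →
             q ^ n ≤ l + M
    q^n≤l+ {M} g g-separates =
      injective-⊎⇒≤ {f = λ d → classify (Member? (decode d))}
        (decode-injective ∘ classify-injective _ _)
      where
      classify : ∀ {u} → Dec (Member L u) → Fin l ⊎ Fin M
      classify {u} (yes (u≉0 , u∈L)) = inj₁ (η.to ((u , u≉0) , u∈L))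
      classify {u} (no _)            = inj₂ (g u)
      classify-injective : ∀ {u w} (u? : Dec (Member L u)) (w? : Dec (Member L w)) →
                           classify u? ≡ classify w? → u ≈ᴹ w
      classify-injective (yes (_ , u∈L)) (yes (_ , w∈L)) eq =
        ≈ᴹ-trans (≈ᴹ-sym (η.strictlyInverseʳ (_ , u∈L))) (η.inverseʳ (inj₁-injective eq))
      classify-injective (no u∉L) (no w∉L) eq = g-separates u∉L w∉L (inj₂-injective eq)

    module _ (L-LD : IsLocatingDominating Γ L) where

      -- A non-zero vector outside `L` is labelled by its trace on `L`, and location says that
      -- traces separate. The extra label `zero` is for `0ᴹ`, which is not a vertex.
      q^n≤l+1+2^l : q ^ n ≤ l + suc (2 ^ l)
      q^n≤l+1+2^l = q^n≤l+ (λ u → trace (u ≟ᴹ 0ᴹ)) λ u∉L w∉L → separates u∉L w∉L (_ ≟ᴹ _) (_ ≟ᴹ _)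
        where
        trace : ∀ {u} → Dec (u ≈ᴹ 0ᴹ) → Fin (suc (2 ^ l))
        trace     (yes _)  = zero
        trace {u} (no u≉0) = suc (indicator λ j → (u , u≉0) ~? element j)
        trace-⊆ : ∀ {u w} →
                  indicator (λ j → u ~? element j) ≡ indicator (λ j → w ~? element j) →
                  ∀ {v} → u ~ v × v ∈ member L → w ~ v × v ∈ member L
        trace-⊆ {u} {w} eq {v} (u~v , v∈L) with j , eⱼ≈v ← ∈⇒element {v} v∈L =
          resp-~ {w} {element j} {v} eⱼ≈v
            (indicator-⊆ (λ j → u ~? element j) (λ j → w ~? element j) eq j
              (resp-~ {u} {v} {element j} (≈ᴹ-sym eⱼ≈v) u~v)) , v∈L
          where
          resp-~ : ∀ {u v w} → proj₁ v ≈ᴹ proj₁ w → u ~ v → u ~ w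
          resp-~ {u} {v} {w} = proj₁ (SimpleGraph.~-resp-≈ Γ) {u} {v} {w}
        separates : ∀ {u w} → u ∉ Member L → w ∉ Member L → (u? : Dec (u ≈ᴹ 0ᴹ)) (w? : Dec (w ≈ᴹ 0ᴹ)) →
                    trace u? ≡ trace w? → u ≈ᴹ w
        separates _ _ (yes u≈0) (yes w≈0) _ = ≈ᴹ-trans u≈0 (≈ᴹ-sym w≈0)
        separates {u} {w} u∉L w∉L (no u≉0) (no w≉0) eq = decidable-stable (u ≟ᴹ w) λ u≉w →
          proj₁ (proj₂ (L-LD (u , u≉0) (w , w≉0) (u∉L ∘ (u≉0 ,_)) (w∉L ∘ (w≉0 ,_)) u≉w))
            ( (λ {v} → trace-⊆ {u , u≉0} {w , w≉0} (Fin.suc-injective eq) {v})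
            , (λ {v} → trace-⊆ {w , w≉0} {u , u≉0} (Fin.suc-injective (sym eq)) {v}))

      -- The label is the support. Here `0ᴹ` takes the empty support, so `2 ^ n` labels suffice.
      q^n≤l+2^n : q ^ n ≤ l + 2 ^ n
      q^n≤l+2^n = q^n≤l+ (λ u → indicator (support? u)) λ {u} {w} u∉L w∉L eq →
        separates u∉L w∉L (indicator-⊆ (support? u) (support? w) eq)
          (indicator-⊆ (support? w) (support? u) (sym eq))
        where
        Support : Carrierᴹ → Pred (Fin n) _
        Support u i = coefficient u i ≉ 0#
        support? : ∀ u → Decidable (Support u)
        support? u i = ¬? (coefficient u i ≟ 0#)
        -- A common index carries over along the inclusion of supports. The remaining obstacle, `w`
        -- equal to `v`, is excluded because `v` lies in `L` and `w` does not.
        twins : ∀ {u w} → w ∉ member L → (∀ i → Support (proj₁ u) i → Support (proj₁ w) i) →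
                ∀ {v} → u ~ v × v ∈ member L → w ~ v × v ∈ member L
        twins w∉L u⊆w ((_ , i , uᵢ , vᵢ) , v∈L) =
          ((λ w≈v → w∉L (resp L (≈ᴹ-sym w≈v) v∈L)) , i , u⊆w i uᵢ , vᵢ) , v∈L
        separates : ∀ {u w} → u ∉ Member L → w ∉ Member L →
                    (∀ i → Support u i → Support w i) → (∀ i → Support w i → Support u i) → u ≈ᴹ w
        separates {u} {w} u∉L w∉L u⊆w w⊆u = decidable-stable (u ≟ᴹ w) λ u≉w →
          let u≉0 = ≉0 u≉w w⊆u
              w≉0 = ≉0 (u≉w ∘ ≈ᴹ-sym) u⊆w
          in proj₁ (proj₂ (L-LD (u , u≉0) (w , w≉0) (u∉L ∘ (u≉0 ,_)) (w∉L ∘ (w≉0 ,_)) u≉w))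
            ( (λ {v} → twins {u , u≉0} {w , w≉0} (w∉L ∘ (w≉0 ,_)) u⊆w {v})
            , (λ {v} → twins {w , w≉0} {u , u≉0} (u∉L ∘ (u≉0 ,_)) w⊆u {v}))
          where
          -- If `u` were zero, `w` would be non-zero, and an index of its support would give `u` a
          -- non-zero coefficient.
          ≉0 : ∀ {u w} → u ≉ᴹ w → (∀ i → Support w i → Support u i) → u ≉ᴹ 0ᴹ
          ≉0 u≉w w⊆u u≈0
            with i , wᵢ ← ≉0ᴹ⇒coefficient≉0 (λ w≈0 → u≉w (≈ᴹ-trans u≈0 (≈ᴹ-sym w≈0))) =
            coefficient≉0⇒≉0ᴹ (w⊆u i wᵢ) u≈0

  -- Locating-dominating sets from multiples of the basis vectors.

  module _ {t : Carrier} (t≉0 : t ≉ 0#) where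

    private
      δ : Fin n → Vector Carrier n
      δ i = updateAt (replicate n 0#) i (const t)

    coefficient-δᵢ : ∀ i → coefficient (lc (δ i)) i ≈ t
    coefficient-δᵢ i = K.trans (coefficient-lc (δ i) i) (K.reflexive (updateAt-updates i (replicate n 0#)))

    coefficient-δⱼ : ∀ {i j} → j ≢ i → coefficient (lc (δ i)) j ≈ 0#
    coefficient-δⱼ {i} {j} j≢i =
      K.trans (coefficient-lc (δ i) j) (K.reflexive (updateAt-minimal j i (replicate n 0#) j≢i))

    coefficient-δᵢ≉0 : ∀ i → coefficient (lc (δ i)) i ≉ 0#
    coefficient-δᵢ≉0 i eq = t≉0 (K.trans (K.sym (coefficient-δᵢ i)) eq)

    axis : Fin n → Vertex
    axis i = lc (δ i) , coefficient≉0⇒≉0ᴹ (coefficient-δᵢ≉0 i)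

    -- The index `i` is the only one at which `axis i` is non-zero, so only it can witness the
    -- adjacency.
    ~-axis : ∀ {u i} → u ~ axis i → coefficient (proj₁ u) i ≉ 0#
    ~-axis {u} {i} (_ , j , uⱼ , δⱼ) with j Fin.≟ i
    ... | yes refl = uⱼ
    ... | no j≢i   = contradiction (coefficient-δⱼ j≢i) δⱼ

    axis-injective : ∀ {i j} → proj₁ (axis i) ≈ᴹ proj₁ (axis j) → i ≡ j
    axis-injective {i} {j} eq = decidable-stable (i Fin.≟ j) λ i≢j →
      coefficient-δᵢ≉0 i (K.trans (coefficient-cong eq i) (coefficient-δⱼ i≢j))

    axes-locatingDominating : (L : VertexSet Γ) → (∀ i → axis i ∈ member L) →
      (∀ {u} → u ∉ member L → ∀ i → coefficient (proj₁ u) i ≈ 0# ⊎ coefficient (proj₁ u) i ≈ 1#) →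
      IsLocatingDominating Γ L
    axes-locatingDominating L axis∈L binary u w u∉L w∉L u≉w = dominated u∉L , separated , dominated w∉L
      where
      adjacent : ∀ {u i} → u ∉ member L → coefficient (proj₁ u) i ≉ 0# → u ~ axis i × axis i ∈ member L
      adjacent {u} {i} u∉L uᵢ≉0 =
        -- Adjacency requires distinct vectors: `axis i` belongs to `L` and `u` does not.
        ((λ u≈δᵢ → u∉L (resp L (≈ᴹ-sym u≈δᵢ) (axis∈L i))) , i , uᵢ≉0 , coefficient-δᵢ≉0 i) , axis∈L i
      dominated : ∀ {u} → u ∉ member L → ∃[ v ] u ~ v × v ∈ member L
      dominated {u , u≉0} u∉L with i , uᵢ≉0 ← ≉0ᴹ⇒coefficient≉0 u≉0 = axis i , adjacent {u , u≉0} u∉L uᵢ≉0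
      separated : ¬ (N u ∩ member L ≐ N w ∩ member L)
      separated (Nu⊆Nw , Nw⊆Nu) with i , uᵢ≉wᵢ ← ≉ᴹ⇒coefficient≉ u≉w
        with binary {u} u∉L i | binary {w} w∉L i
      -- At an index where `u` and `w` differ, one coefficient is 0 and the other is not. The vertex
      -- `axis i` then lies in exactly one of the two traces.
      ... | inj₁ uᵢ≈0 | _ =
        ~-axis {u} (proj₁ (Nw⊆Nu {axis i} (adjacent {w} w∉L λ wᵢ≈0 → uᵢ≉wᵢ (K.trans uᵢ≈0 (K.sym wᵢ≈0))))) uᵢ≈0
      ... | inj₂ _    | inj₁ wᵢ≈0 =
        ~-axis {w} (proj₁ (Nu⊆Nw {axis i} (adjacent {u} u∉L λ uᵢ≈0 → uᵢ≉wᵢ (K.trans uᵢ≈0 (K.sym wᵢ≈0))))) wᵢ≈0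
      ... | inj₂ uᵢ≈1 | inj₂ wᵢ≈1 = uᵢ≉wᵢ (K.trans uᵢ≈1 (K.sym wᵢ≈1))

  -- The value for the field with two elements.

  λ[q≡2] : q ≡ 2 → 3 ≤ n → IsLocationDominationNumber Γ n
  λ[q≡2] refl 3≤n = (L , L-LD , image-hasCardinality Γ {f = axis 1≉0} (axis-injective 1≉0)) , lower
    where
    1≉0 : 1# ≉ 0#
    1≉0 = 0≉1 F ∘ K.sym
    L : VertexSet Γ
    L = image Γ (axis 1≉0)
    binary : ∀ x → x ≈ 0# ⊎ x ≈ 1#
    -- The codes of `0#` and `1#` are distinct, so they exhaust `Fin 2`.
    binary x = Sum.map to-injective to-injective
      (Fin2-dichotomy (0≉1 F ∘ to-injective) (ι.to x))
    L-LD : IsLocatingDominating Γ L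
    L-LD = axes-locatingDominating 1≉0 L (λ i → i , ≈ᴹ-refl) (λ {u} _ i → binary (coefficient (proj₁ u) i))
    lower : ∀ M l → IsLocatingDominating Γ M → elements M HasCardinality l → n ≤ l
    lower M l M-LD card-M = 2^n≤l+1+2^l⇒n≤l 3≤n (Enumerated.q^n≤l+1+2^l M card-M M-LD)

  -- The value for fields with at least three elements.

  λ[q≥3] : 3 ≤ q → IsLocationDominationNumber Γ (∑₁ n (λ i → (n C i) * ((q ∸ 1) ^ i ∸ 1)))
  λ[q≥3] 3≤q = (L , L-LD , subst (elements L HasCardinality_) (sym λΓ≡size) card-L) , lower
    where
    λΓ : ℕ
    λΓ = ∑₁ n (λ i → (n C i) * ((q ∸ 1) ^ i ∸ 1))
    λΓ+2^n≡q^n : λΓ + 2 ^ n ≡ q ^ n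
    λΓ+2^n≡q^n = Σ-binomial q n (≤-trans (n≤1+n 2) 3≤q)

    lower : ∀ M l → IsLocatingDominating Γ M → elements M HasCardinality l → λΓ ≤ l
    lower M l M-LD card-M = +-cancelʳ-≤ (2 ^ n) _ _
      (≤-trans (≤-reflexive λΓ+2^n≡q^n) (Enumerated.q^n≤l+2^n M card-M M-LD))

    NonBinary : Pred Carrierᴹ _
    NonBinary u = ∃[ i ] coefficient u i ≉ 0# × coefficient u i ≉ 1#
    nonBinary? : Decidable NonBinary
    nonBinary? u = Fin.any? λ i → ¬? (coefficient u i ≟ 0#) ×-dec ¬? (coefficient u i ≟ 1#)
    nonBinary-resp : ∀ {u w} → u ≈ᴹ w → NonBinary u → NonBinary w
    nonBinary-resp u≈w (i , uᵢ≉0 , uᵢ≉1) =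
      i , uᵢ≉0 ∘ K.trans (coefficient-cong u≈w i) , uᵢ≉1 ∘ K.trans (coefficient-cong u≈w i)

    enumeration = enumerate (nonBinary? ∘ decode)
    size : ℕ
    size = proj₁ enumeration
    f : Fin size → Fin (q ^ n)
    f = proj₁ (proj₂ enumeration)
    f-injective : Injective _≡_ _≡_ f
    f-injective = proj₁ (proj₂ (proj₂ enumeration))
    f-nonBinary : ∀ j → NonBinary (decode (f j))
    f-nonBinary = proj₁ (proj₂ (proj₂ (proj₂ enumeration)))
    f-complete : ∀ d → NonBinary (decode d) → ∃[ j ] f j ≡ d
    f-complete = proj₂ (proj₂ (proj₂ (proj₂ enumeration)))

    φ : Fin size → Vertex
    φ j with _ , uᵢ≉0 , _ ← f-nonBinary j = decode (f j) , coefficient≉0⇒≉0ᴹ uᵢ≉0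
    L : VertexSet Γ
    L = image Γ φ
    card-L : elements L HasCardinality size
    card-L = image-hasCardinality Γ {f = φ} (f-injective ∘ decode-injective)
    nonBinary⇒∈L : ∀ {u} → NonBinary (proj₁ u) → u ∈ member L
    nonBinary⇒∈L {u , _} u-nonBinary
      with j , fⱼ≡ ← f-complete (encode u) (nonBinary-resp (≈ᴹ-sym (decode-encode u)) u-nonBinary) =
      j , subst (λ d → decode d ≈ᴹ u) (sym fⱼ≡) (decode-encode u)
    ∉L⇒binary : ∀ {u} → u ∉ member L → ∀ i → coefficient (proj₁ u) i ≈ 0# ⊎ coefficient (proj₁ u) i ≈ 1#
    ∉L⇒binary {u} u∉L i with coefficient (proj₁ u) i ≟ 0# | coefficient (proj₁ u) i ≟ 1#
    ... | yes uᵢ≈0 | _        = inj₁ uᵢ≈0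
    ... | no _     | yes uᵢ≈1 = inj₂ uᵢ≈1
    ... | no uᵢ≉0  | no uᵢ≉1  = contradiction (nonBinary⇒∈L {u} (i , uᵢ≉0 , uᵢ≉1)) u∉L

    L-LD : IsLocatingDominating Γ L
    -- A third scalar `t` exists because `q ≥ 3`. Being neither 0 nor 1, it makes every `axis i`
    -- non-binary and so puts it in `L`.
    L-LD with s , s≢0 , s≢1 ← avoid-two 3≤q (ι.to 0#) (ι.to 1#) =
      axes-locatingDominating t≉0 L
        (λ i → nonBinary⇒∈L {axis t≉0 i}
          (i , coefficient-δᵢ≉0 t≉0 i , λ eq → t≉1 (K.trans (K.sym (coefficient-δᵢ t≉0 i)) eq)))
        (λ {u} → ∉L⇒binary {u})
      where
      from≉ : ∀ {x} → s ≢ ι.to x → ι.from s ≉ x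
      from≉ s≢x eq = s≢x (trans (sym (ι.strictlyInverseˡ s)) (ι.to-cong eq))
      t≉0 = from≉ s≢0
      t≉1 = from≉ s≢1

    bit : Fin 2 → Carrier
    bit 0F = 0#
    bit 1F = 1#
    bit-injective : Injective _≡_ _≈_ bit
    bit-injective {0F} {0F} _  = refl
    bit-injective {0F} {1F} eq = contradiction eq (0≉1 F)
    bit-injective {1F} {0F} eq = contradiction (K.sym eq) (0≉1 F)
    bit-injective {1F} {1F} _  = refl
    bit-binary : ∀ {x} a → x ≈ bit a → x ≉ 0# → x ≉ 1# → ⊥
    bit-binary 0F eq x≉0 _   = x≉0 eq
    bit-binary 1F eq _   x≉1 = x≉1 eq

    -- The codes of the `2 ^ n` binary vectors, `0ᴹ` included. They are disjoint from the codes
    -- listed by `f`, which bounds `size` from above.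
    g : Fin (2 ^ n) → Fin (q ^ n)
    g s = encode (lc (bit ∘ finToFun {2} {n} s))
    g-injective : Injective _≡_ _≡_ g
    g-injective eq = finToFun-injective {2} {n} (bit-injective ∘ encode-lc-injective eq)
    disjoint : ∀ i s → f i ≢ g s
    disjoint i s eq
      with j , uⱼ≉0 , uⱼ≉1 ← nonBinary-resp (decode-encode _) (subst (NonBinary ∘ decode) eq (f-nonBinary i)) =
      bit-binary (finToFun s j) (coefficient-lc (bit ∘ finToFun {2} {n} s) j) uⱼ≉0 uⱼ≉1

    -- No direct count of `L` is made. The lower bound applied to `L` itself gives `λΓ ≤ size`, and
    -- the disjoint injections `f` and `g` give `size + 2 ^ n ≤ q ^ n`, where `q ^ n` is
    -- `λΓ + 2 ^ n`.
    λΓ≡size : λΓ ≡ size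
    λΓ≡size = ≤-antisym (lower L size L-LD card-L)
      (+-cancelʳ-≤ (2 ^ n) _ _
        (≤-trans (⊎-injective⇒≤ f-injective g-injective disjoint) (≤-reflexive (sym λΓ+2^n≡q^n))))

theorem2p7 : ∀ {c ℓ₁ ℓ₂ m ℓm : Level}
    (F : HeytingField c ℓ₁ ℓ₂) (q : ℕ) →
    CommutativeRing.setoid (fieldRing F) HasCardinality q →
    (V : VectorSpace F m ℓm) (n : ℕ) → 1 ≤ n →
    (b : Vector (Module.Carrierᴹ V) n) (B : IsBasis F V b) →
    (q ≡ 2 → 3 ≤ n →
    IsLocationDominationNumber (nonZeroComponentGraph F V B) n)
    ×
    (3 ≤ q →
    IsLocationDominationNumber (nonZeroComponentGraph F V B)
    (∑₁ n (λ i → (n C i) * ((q ∸ 1) ^ i ∸ 1))))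
theorem2p7 F q card V n _ b B = λ[q≡2] F card V B , λ[q≥3] F card V B
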